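{- For every GKAT expression $e\in\mathrm{Exp}$, the Thompson automaton $\mathcal{X}_e^\iota$ for $e$ recognizes $[\![e]\!]$, that is, $\ell^{\mathcal{X}_e^\iota}(\iota)=[\![e]\!]$.
   Context: Syntax. Fix disjoint nonempty sets $\Sigma$ (actions) and $T=\{t_1,\dots,t_n\}$ (primitive tests), $T$ finite. Boolean expressions $b,c\in\mathrm{BExp}$ are generated by $0 \mid 1 \mid t\in T \mid b\cdot c \mid b+c \mid \overline{b}$. GKAT expressions $e,f\in\mathrm{Exp}$ are generated by $p\in\Sigma \mid b\in\mathrm{BExp} \mid e\cdot f \mid e+_b f \mid e^{(b)}$. $\equiv_{BA}$ denotes Boolean equivalence, $b\le c$ iff $b+c\equiv_{BA}c$. $\mathrm{At}$ is the finite set of atoms (minimal nonzero elements) of the free Boolean algebra $\mathrm{BExp}/{\equiv_{BA}}$ on $T$. Language model. Guarded strings: $\mathrm{GS}=\mathrm{At}\cdot(\Sigma\cdot\mathrm{At})^*$. Fusion product: $x\alpha\diamond\beta y = x\alpha y$ if $\alpha=\beta$, undefined otherwise; for $L,K\subseteq\mathrm{GS}$, $L\diamond K=\{x\diamond y : x\in L,y\in K, x\diamond y\text{ defined}\}$; $L^0=\mathrm{At}$, $L^{n+1}=L^n\diamond L$. For $B\subseteq\mathrm{At}$, $\overline{B}=\mathrm{At}\setminus B$, $L+_BK=(B\diamond L)\cup(\overline{B}\diamond K)$, $L^{(B)}=\bigcup_{n\ge0}(B\diamond L)^n\diamond\overline{B}$. Then $[\![-]\!]:\mathrm{Exp}\to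 2^{\mathrm{GS}}$ is: $[\![p]\!]=\{\alpha p\beta:\alpha,\beta\in\mathrm{At}\}$, $[\![b]\!]=\{\alpha\in\mathrm{At}:\alpha\le b\}$, $[\![e\cdot f]\!]=[\![e]\!]\diamond[\![f]\!]$, $[\![e+_bf]\!]=[\![e]\!]+_{[\![b]\!]}[\![f]\!]$, $[\![e^{(b)}]\!]=[\![e]\!]^{([\![b]\!])}$. Automata. Let $GX=(2+\Sigma\times X)^{\mathrm{At}}$ with $2=\{0,1\}$. A $G$-coalgebra is a pair $\mathcal{X}=\langle X,\delta^{\mathcal{X}}\rangle$ with $\delta^{\mathcal{X}}:X\to GX$; a $G$-automaton is a $G$-coalgebra with a designated start state. The language $\ell^{\mathcal{X}}(s)\subseteq\mathrm{GS}$ of a state $s$ is defined inductively: $\alpha\in\ell^{\mathcal{X}}(s)$ iff $\delta^{\mathcal{X}}(s)(\alpha)=1$; $\alpha px\in\ell^{\mathcal{X}}(s)$ iff $\delta^{\mathcal{X}}(s)(\alpha)=(p,t)$ for some $t$ with $x\in\ell^{\mathcal{X}}(t)$. Thompson construction. For $\langle X,\delta\rangle$, $Y\subseteq X$, $h\in GX$, the uniform continuation $\delta[Y,h]:X\to GX$ is $\delta[Y,h](x)(\alpha)=h(\alpha)$ if $x\in Y$ and $\delta(x)(\alpha)=1$, and $\delta[Y,h](x)(\alpha)=\delta(x)(\alpha)$ otherwise. $\delta_1+\delta_2$ denotes the coproduct structure on the disjoint union $X+Y$. For each $e\in\mathrm{Exp}$ define a $G$-coalgebra $\mathcal{X}_e=\langle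 X_e,\delta_e\rangle$ and an initial pseudostate $\iota_e\in GX_e$ by recursion: - $e=b$: $X_b=\emptyset$, $\iota_b(\alpha)=1$ if $\alpha\le b$, else $0$. - $e=p$: $X_p=\{*\}$, $\delta_p(*)(\alpha)=1$ for all $\alpha$, $\iota_p(\alpha)=(p,*)$. - $e=f+_bg$: $X_e=X_f+X_g$, $\delta_e=\delta_f+\delta_g$, $\iota_e(\alpha)=\iota_f(\alpha)$ if $\alpha\le b$, $\iota_g(\alpha)$ if $\alpha\le\overline{b}$. - $e=f\cdot g$: $X_e=X_f+X_g$, $\delta_e=(\delta_f+\delta_g)[X_f,\iota_g]$, $\iota_e(\alpha)=\iota_f(\alpha)$ if $\iota_f(\alpha)\ne1$, $\iota_g(\alpha)$ if $\iota_f(\alpha)=1$. - $e=f^{(b)}$: $X_e=X_f$, $\iota_e(\alpha)=1$ if $\alpha\le\overline{b}$; $0$ if $\alpha\le b$ and $\iota_f(\alpha)=1$; $\iota_f(\alpha)$ if $\alpha\le b$ and $\iota_f(\alpha)\ne1$; $\delta_e=\delta_f[X_f,\iota_e]$. The Thompson automaton is $\mathcal{X}_e^\iota=\langle\{\iota\}+X_e,\delta_e^\iota,\iota\rangle$ with $\delta_e^\iota(x)=\delta_e(x)$ for $x\in X_e$ and $\delta_e^\iota(\iota)=\iota_e$. -}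

module Defs where

open import Algebra.Lattice.Bundles using (BooleanAlgebra)
import Algebra.Lattice.Properties.BooleanAlgebra as BooleanAlgebraProperties
open import Data.Bool using (Bool; true; false; not; _∧_; _∨_; if_then_else_)
import Data.Bool.Properties as Bool
open import Data.Empty using (⊥)
open import Data.Fin using (Fin; zero; suc)
open import Data.Maybe as Maybe using (Maybe; just; nothing)
open import Data.Nat using (ℕ; zero; suc)
open import Data.Product using (∃-syntax; _×_; _,_; proj₁; proj₂)
open import Data.Sum using (_⊎_; inj₁; inj₂; [_,_])
open import Data.Unit using (⊤; tt)
open import Data.Vec using (Vec; []; _∷_; lookup)
open import Data.Vec.Properties using (≡-dec; tabulate∘lookup; tabulate-cong)
import Data.Vec.Functional as Vector
open import Function using (_∘_)
open import Level using (0ℓ)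
open import Relation.Binary.Definitions using (DecidableEquality)
open import Relation.Binary.PropositionalEquality
  using (_≡_; refl; sym; trans; cong; cong₂)
open import Relation.Nullary using (¬_; Dec; yes; no; does; contradiction)
open import Relation.Nullary.Decidable using (map′)
open import Relation.Unary using (Pred; _∈_; ∁; _∪_)

-- The primitive tests t₁, …, tₙ are the elements of Fin n.

module GKAT (Action : Set) (n : ℕ) where

  infixr 7 _·ᵇ_
  infixr 6 _+ᵇ_
  infix  8 ∼_

  data BExp : Set where
    𝟎 𝟏   : BExp
    prim  : Fin n → BExp
    _·ᵇ_  : BExp → BExp → BExp
    _+ᵇ_  : BExp → BExp → BExp
    ∼_    : BExp → BExp

  infixr 7 _·_
  infixr 6 _+[_]_
  infix  8 _^[_]

  data Exp : Set where
    act    : Action → Exp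
    test   : BExp → Exp
    _·_    : Exp → Exp → Exp
    _+[_]_ : Exp → BExp → Exp → Exp
    _^[_]  : Exp → BExp → Exp

  infix 4 _≡BA_ _≤_

  -- The least congruence containing the Boolean algebra axioms, so that
  -- the setoid (BExp , _≡BA_) is the free Boolean algebra on Fin n.

  data _≡BA_ : BExp → BExp → Set where
    ≡-refl   : ∀ {b} → b ≡BA b
    ≡-sym    : ∀ {b c} → b ≡BA c → c ≡BA b
    ≡-trans  : ∀ {b c d} → b ≡BA c → c ≡BA d → b ≡BA d
    +-cong   : ∀ {b b′ c c′} → b ≡BA b′ → c ≡BA c′ → b +ᵇ c ≡BA b′ +ᵇ c′
    ·-cong   : ∀ {b b′ c c′} → b ≡BA b′ → c ≡BA c′ → b ·ᵇ c ≡BA b′ ·ᵇ c′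
    ∼-cong   : ∀ {b b′} → b ≡BA b′ → ∼ b ≡BA ∼ b′
    +-comm   : ∀ b c → b +ᵇ c ≡BA c +ᵇ b
    ·-comm   : ∀ b c → b ·ᵇ c ≡BA c ·ᵇ b
    +-assoc  : ∀ b c d → (b +ᵇ c) +ᵇ d ≡BA b +ᵇ (c +ᵇ d)
    ·-assoc  : ∀ b c d → (b ·ᵇ c) ·ᵇ d ≡BA b ·ᵇ (c ·ᵇ d)
    +-absorb : ∀ b c → b +ᵇ (b ·ᵇ c) ≡BA b
    ·-absorb : ∀ b c → b ·ᵇ (b +ᵇ c) ≡BA b
    +-distrib : ∀ b c d → b +ᵇ (c ·ᵇ d) ≡BA (b +ᵇ c) ·ᵇ (b +ᵇ d)
    ·-distrib : ∀ b c d → b ·ᵇ (c +ᵇ d) ≡BA (b ·ᵇ c) +ᵇ (b ·ᵇ d)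
    +-compl  : ∀ b → b +ᵇ ∼ b ≡BA 𝟏
    ·-compl  : ∀ b → b ·ᵇ ∼ b ≡BA 𝟎

  _≤_ : BExp → BExp → Set
  b ≤ c = b +ᵇ c ≡BA c

  freeBooleanAlgebra : BooleanAlgebra 0ℓ 0ℓ
  freeBooleanAlgebra = record
    { Carrier = BExp ; _≈_ = _≡BA_
    ; _∨_ = _+ᵇ_ ; _∧_ = _·ᵇ_ ; ¬_ = ∼_ ; ⊤ = 𝟏 ; ⊥ = 𝟎
    ; isBooleanAlgebra = record
      { isDistributiveLattice = record
        { isLattice = record
          { isEquivalence = record
            { refl = ≡-refl ; sym = ≡-sym ; trans = ≡-trans }
          ; ∨-comm = +-comm ; ∨-assoc = +-assoc ; ∨-cong = +-cong
          ; ∧-comm = ·-comm ; ∧-assoc = ·-assoc ; ∧-cong = ·-cong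
          ; absorptive = +-absorb , ·-absorb
          }
        ; ∨-distrib-∧ = +-distrib ,
            λ b c d → ≡-trans (+-comm (c ·ᵇ d) b)
                     (≡-trans (+-distrib b c d)
                              (·-cong (+-comm b c) (+-comm b d)))
        ; ∧-distrib-∨ = ·-distrib ,
            λ b c d → ≡-trans (·-comm (c +ᵇ d) b)
                     (≡-trans (·-distrib b c d)
                              (+-cong (·-comm b c) (·-comm b d)))
        }
      ; ∨-complement = (λ b → ≡-trans (+-comm (∼ b) b) (+-compl b)) , +-compl
      ; ∧-complement = (λ b → ≡-trans (·-comm (∼ b) b) (·-compl b)) , ·-compl
      ; ¬-cong = ∼-cong
      }
    }

  IsAtom : BExp → Set
  IsAtom b = ¬ (b ≡BA 𝟎) × (∀ c → ¬ (c ≡BA 𝟎) → c ≤ b → c ≡BA b)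

  -- Agda has no quotient types, so an atom of the free Boolean algebra is
  -- given by its canonical representative, the product of n literals ⌜ α ⌝
  -- in which the i-th test is positive iff the i-th entry of α is true.
  -- ⌜⌝-isAtom, ⌜⌝-injective and ⌜⌝-surjective below prove that ⌜_⌝ is a
  -- bijection from At to the minimal nonzero elements of BExp / ≡BA.

  At : Set
  At = Vec Bool n

  polar : Bool → BExp → BExp
  polar true  b = b
  polar false b = ∼ b

  ⋀ : ∀ {m} → (Fin m → BExp) → BExp
  ⋀ = Vector.foldr _·ᵇ_ 𝟏

  ⌜_⌝ : At → BExp
  ⌜ α ⌝ = ⋀ (λ i → polar (lookup α i) (prim i))

  _≟_ : DecidableEquality At
  _≟_ = ≡-dec Bool._≟_

  private
    open BooleanAlgebraProperties freeBooleanAlgebra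
      using ( ∨-idem; ∨-identityʳ; ∧-identityˡ; ∨-zeroʳ
            ; ¬⊥≈⊤; ¬-involutive; deMorgan₁; deMorgan₂ )

    infixr 5 _⨾_
    _⨾_ : ∀ {b c d} → b ≡BA c → c ≡BA d → b ≡BA d
    _⨾_ = ≡-trans

    ≤-trans : ∀ {b c d} → b ≤ c → c ≤ d → b ≤ d
    ≤-trans {b} {c} {d} p q =
      +-cong ≡-refl (≡-sym q) ⨾ ≡-sym (+-assoc b c d) ⨾ +-cong p ≡-refl ⨾ q

    ≤-reflexive : ∀ {b c} → b ≡BA c → b ≤ c
    ≤-reflexive {b} {c} p = +-cong p ≡-refl ⨾ ∨-idem c

    ≤-antisym : ∀ {b c} → b ≤ c → c ≤ b → b ≡BA c
    ≤-antisym {b} {c} p q = ≡-sym q ⨾ +-comm c b ⨾ p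

    ·-lower : ∀ b c → b ·ᵇ c ≤ b
    ·-lower b c = +-comm (b ·ᵇ c) b ⨾ +-absorb b c

    ·-lowerʳ : ∀ b c → b ·ᵇ c ≤ c
    ·-lowerʳ b c = ≤-trans (≤-reflexive (·-comm b c)) (·-lower c b)

    ·-greatest : ∀ {a b c} → a ≤ b → a ≤ c → a ≤ b ·ᵇ c
    ·-greatest {a} {b} {c} p q = +-distrib a b c ⨾ ·-cong p q

    +-upper : ∀ b c → b ≤ b +ᵇ c
    +-upper b c = ≡-sym (+-assoc b b c) ⨾ +-cong (∨-idem b) ≡-refl

    +-upperʳ : ∀ b c → c ≤ b +ᵇ c
    +-upperʳ b c = ≤-trans (+-upper c b) (≤-reflexive (+-comm c b))

    ≤𝟎⇒≡𝟎 : ∀ {b} → b ≤ 𝟎 → b ≡BA 𝟎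
    ≤𝟎⇒≡𝟎 {b} p = ≡-sym (∨-identityʳ b) ⨾ p

    eval : BExp → At → Bool
    eval 𝟎         α = false
    eval 𝟏         α = true
    eval (prim i)  α = lookup α i
    eval (b ·ᵇ c)  α = eval b α ∧ eval c α
    eval (b +ᵇ c)  α = eval b α ∨ eval c α
    eval (∼ b)     α = not (eval b α)

    eval-sound : ∀ {b c} → b ≡BA c → ∀ α → eval b α ≡ eval c α
    eval-sound ≡-refl α = refl
    eval-sound (≡-sym p) α = sym (eval-sound p α)
    eval-sound (≡-trans p q) α = trans (eval-sound p α) (eval-sound q α)
    eval-sound (+-cong p q) α = cong₂ _∨_ (eval-sound p α) (eval-sound q α)
    eval-sound (·-cong p q) α = cong₂ _∧_ (eval-sound p α) (eval-sound q α)
    eval-sound (∼-cong p) α = cong not (eval-sound p α)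
    eval-sound (+-comm b c) α = Bool.∨-comm (eval b α) (eval c α)
    eval-sound (·-comm b c) α = Bool.∧-comm (eval b α) (eval c α)
    eval-sound (+-assoc b c d) α = Bool.∨-assoc (eval b α) (eval c α) (eval d α)
    eval-sound (·-assoc b c d) α = Bool.∧-assoc (eval b α) (eval c α) (eval d α)
    eval-sound (+-absorb b c) α = Bool.∨-abs-∧ (eval b α) (eval c α)
    eval-sound (·-absorb b c) α = Bool.∧-abs-∨ (eval b α) (eval c α)
    eval-sound (+-distrib b c d) α = Bool.∨-distribˡ-∧ (eval b α) (eval c α) (eval d α)
    eval-sound (·-distrib b c d) α = Bool.∧-distribˡ-∨ (eval b α) (eval c α) (eval d α)
    eval-sound (+-compl b) α = Bool.∨-inverseʳ (eval b α)
    eval-sound (·-compl b) α = Bool.∧-inverseʳ (eval b α)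

    ⋀-lower : ∀ {m} (k : Fin m → BExp) i → ⋀ k ≤ k i
    ⋀-lower k zero    = ·-lower _ _
    ⋀-lower k (suc i) = ≤-trans (·-lowerʳ (k zero) _) (⋀-lower (k ∘ suc) i)

    decide : ∀ α b → ⌜ α ⌝ ≤ polar (eval b α) b
    decide α 𝟎 = ≤-trans (∨-zeroʳ _) (≤-reflexive (≡-sym ¬⊥≈⊤))
    decide α 𝟏 = ∨-zeroʳ _
    decide α (prim i) = ⋀-lower (λ j → polar (lookup α j) (prim j)) i
    decide α (b ·ᵇ c) with eval b α | eval c α | decide α b | decide α c
    ... | true  | true  | p | q = ·-greatest p q
    ... | true  | false | p | q =
      ≤-trans q (≤-trans (+-upperʳ (∼ b) (∼ c)) (≤-reflexive (≡-sym (deMorgan₁ b c))))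
    ... | false | _     | p | q =
      ≤-trans p (≤-trans (+-upper (∼ b) (∼ c)) (≤-reflexive (≡-sym (deMorgan₁ b c))))
    decide α (b +ᵇ c) with eval b α | eval c α | decide α b | decide α c
    ... | true  | _     | p | q = ≤-trans p (+-upper b c)
    ... | false | true  | p | q = ≤-trans q (+-upperʳ b c)
    ... | false | false | p | q =
      ≤-trans (·-greatest p q) (≤-reflexive (≡-sym (deMorgan₂ b c)))
    decide α (∼ b) with eval b α | decide α b
    ... | true  | p = ≤-trans p (≤-reflexive (≡-sym (¬-involutive b)))
    ... | false | p = p

    eval-⋀ : ∀ {m} (k : Fin m → BExp) α →
             (∀ i → eval (k i) α ≡ true) → eval (⋀ k) α ≡ true
    eval-⋀ {zero}  k α p = refl
    eval-⋀ {suc m} k α p = cong₂ _∧_ (p zero) (eval-⋀ (k ∘ suc) α (p ∘ suc))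

    eval-⌜⌝ : ∀ α → eval ⌜ α ⌝ α ≡ true
    eval-⌜⌝ α = eval-⋀ _ α literal
      where
      literal : ∀ i → eval (polar (lookup α i) (prim i)) α ≡ true
      literal i with lookup α i in eq
      ... | true  = eq
      ... | false = cong not eq

    eval-≤ : ∀ {b c} → b ≤ c → ∀ α → eval b α ≡ true → eval c α ≡ true
    eval-≤ {b} {c} p α q =
      trans (sym (eval-sound p α)) (cong (_∨ eval c α) q)

    ≤⇒eval : ∀ α b → ⌜ α ⌝ ≤ b → eval b α ≡ true
    ≤⇒eval α b p = eval-≤ p α (eval-⌜⌝ α)

    eval⇒≤ : ∀ α b → eval b α ≡ true → ⌜ α ⌝ ≤ b
    eval⇒≤ α b p with eval b α | decide α b
    eval⇒≤ α b refl | true | q = q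

  _≤?_ : ∀ α b → Dec (⌜ α ⌝ ≤ b)
  α ≤? b = map′ (eval⇒≤ α b) (≤⇒eval α b) (eval b α Bool.≟ true)

  ≰⇒≤∼ : ∀ α b → ¬ (⌜ α ⌝ ≤ b) → ⌜ α ⌝ ≤ ∼ b
  ≰⇒≤∼ α b α≰b with eval b α | decide α b
  ... | true  | α≤b  = contradiction α≤b α≰b
  ... | false | α≤∼b = α≤∼b

  ≤∼⇒≰ : ∀ α b → ⌜ α ⌝ ≤ ∼ b → ¬ (⌜ α ⌝ ≤ b)
  ≤∼⇒≰ α b α≤∼b α≤b
    with trans (sym (≤⇒eval α (∼ b) α≤∼b)) (cong not (≤⇒eval α b α≤b))
  ... | ()

  ⌜⌝-isAtom : ∀ α → IsAtom ⌜ α ⌝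
  ⌜⌝-isAtom α = nonzero , minimal
    where
    nonzero : ¬ (⌜ α ⌝ ≡BA 𝟎)
    nonzero p with trans (sym (eval-⌜⌝ α)) (eval-sound p α)
    ... | ()

    minimal : ∀ c → ¬ (c ≡BA 𝟎) → c ≤ ⌜ α ⌝ → c ≡BA ⌜ α ⌝
    minimal c c≢𝟎 c≤α with eval c α | decide α c
    ... | true  | α≤c  = ≤-antisym c≤α α≤c
    ... | false | α≤∼c = contradiction
      (≤𝟎⇒≡𝟎 (≤-trans (·-greatest (≤-reflexive ≡-refl) (≤-trans c≤α α≤∼c))
                      (≤-reflexive (·-compl c))))
      c≢𝟎

  ⌜⌝-injective : ∀ α β → ⌜ α ⌝ ≡BA ⌜ β ⌝ → α ≡ β
  ⌜⌝-injective α β p =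
    trans (sym (tabulate∘lookup α))
          (trans (tabulate-cong agree) (tabulate∘lookup β))
    where
    agree : ∀ i → lookup α i ≡ lookup β i
    agree i with lookup β i
               | ≤⇒eval α _ (≤-trans (≤-reflexive p)
                   (⋀-lower (λ j → polar (lookup β j) (prim j)) i))
    ... | true  | q = q
    ... | false | q = Bool.not-injective q

  private
    search : ∀ {m} {P : Vec Bool m → Set} → (∀ v → Dec (P v)) →
             (∃[ v ] P v) ⊎ (∀ v → ¬ P v)
    search {zero} P? with P? []
    ... | yes p = inj₁ ([] , p)
    ... | no ¬p = inj₂ λ { [] → ¬p }
    search {suc m} P? with search (λ v → P? (true ∷ v)) | search (λ v → P? (false ∷ v))
    ... | inj₁ (v , p) | _            = inj₁ (true ∷ v , p)
    ... | inj₂ _       | inj₁ (v , p) = inj₁ (false ∷ v , p)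
    ... | inj₂ f       | inj₂ g       = inj₂ λ { (true ∷ v) → f v ; (false ∷ v) → g v }

    split : ∀ {m} (k : Fin m → BExp) b →
            (∀ (v : Vec Bool m) → ⋀ (λ i → polar (lookup v i) (k i)) ·ᵇ b ≡BA 𝟎) →
            b ≡BA 𝟎
    split {zero}  k b p = ≡-sym (∧-identityˡ b) ⨾ p []
    split {suc m} k b p =
        ≡-sym (∧-identityˡ b)
      ⨾ ·-cong (≡-sym (+-compl (k zero))) ≡-refl
      ⨾ BooleanAlgebra.∧-distribʳ-∨ freeBooleanAlgebra b (k zero) (∼ k zero)
      ⨾ +-cong (half true) (half false)
      ⨾ ∨-identityʳ 𝟎
      where
      half : ∀ s → polar s (k zero) ·ᵇ b ≡BA 𝟎
      half s = split (k ∘ suc) (polar s (k zero) ·ᵇ b) λ v →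
          ≡-sym (·-assoc _ _ _) ⨾ ·-cong (·-comm _ _) ≡-refl ⨾ p (s ∷ v)

  ⌜⌝-surjective : ∀ b → IsAtom b → ∃[ α ] ⌜ α ⌝ ≡BA b
  ⌜⌝-surjective b (b≢𝟎 , minimal) with search (_≤? b)
  ... | inj₁ (α , α≤b) = α , minimal ⌜ α ⌝ (proj₁ (⌜⌝-isAtom α)) α≤b
  ... | inj₂ none = contradiction (split prim b disjoint) b≢𝟎
    where
    disjoint : ∀ α → ⌜ α ⌝ ·ᵇ b ≡BA 𝟎
    disjoint α with eval b α | decide α b | none α
    ... | true  | α≤b  | α≰b = contradiction α≤b α≰b
    ... | false | α≤∼b | _   =
      ≤𝟎⇒≡𝟎 (≤-trans (·-greatest (·-lowerʳ ⌜ α ⌝ b)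
                                 (≤-trans (·-lower ⌜ α ⌝ b) α≤∼b))
                     (≤-reflexive (·-compl b)))

  -- Guarded strings: end α is the string α, and α ⟨ p ⟩ x is the string αpx.

  data GS : Set where
    end   : At → GS
    _⟨_⟩_ : At → Action → GS → GS

  Language : Set₁
  Language = Pred GS 0ℓ

  head : GS → At
  head (end α)     = α
  head (α ⟨ _ ⟩ _) = α

  -- The fusion product is partial; nothing means undefined.

  infixr 7 _⋄_ _◇_

  _⋄_ : GS → GS → Maybe GS
  end α       ⋄ y = if does (α ≟ head y) then just y else nothing
  (α ⟨ p ⟩ x) ⋄ y = Maybe.map (α ⟨ p ⟩_) (x ⋄ y)

  _◇_ : Language → Language → Language
  (L ◇ K) w = ∃[ x ] ∃[ y ] x ∈ L × y ∈ K × x ⋄ y ≡ just w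

  -- A set of atoms, regarded as a set of guarded strings.

  ⌊_⌋ : Pred At 0ℓ → Language
  ⌊ B ⌋ w = ∃[ α ] α ∈ B × w ≡ end α

  _^_ : Language → ℕ → Language
  L ^ zero  = ⌊ (λ _ → ⊤) ⌋
  L ^ suc k = (L ^ k) ◇ L

  guarded-union : Pred At 0ℓ → Language → Language → Language
  guarded-union B L K = (⌊ B ⌋ ◇ L) ∪ (⌊ ∁ B ⌋ ◇ K)

  guarded-iteration : Pred At 0ℓ → Language → Language
  guarded-iteration B L w = ∃[ k ] w ∈ ((⌊ B ⌋ ◇ L) ^ k) ◇ ⌊ ∁ B ⌋

  ⟦_⟧ᵇ : BExp → Pred At 0ℓ
  ⟦ b ⟧ᵇ α = ⌜ α ⌝ ≤ b

  ⟦_⟧ : Exp → Language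
  ⟦ act p ⟧ w    = ∃[ α ] ∃[ β ] w ≡ α ⟨ p ⟩ end β
  ⟦ test b ⟧     = ⌊ ⟦ b ⟧ᵇ ⌋
  ⟦ e · f ⟧      = ⟦ e ⟧ ◇ ⟦ f ⟧
  ⟦ e +[ b ] f ⟧ = guarded-union ⟦ b ⟧ᵇ ⟦ e ⟧ ⟦ f ⟧
  ⟦ e ^[ b ] ⟧   = guarded-iteration ⟦ b ⟧ᵇ ⟦ e ⟧

  Out : Set → Set
  Out X = Bool ⊎ (Action × X)

  pattern reject   = inj₁ false
  pattern accept   = inj₁ true
  pattern step p x = inj₂ (p , x)

  G : Set → Set
  G X = At → Out X

  record Coalgebra : Set₁ where
    field
      State : Set
      δ     : State → G State

  record Automaton : Set₁ where
    field
      coalgebra : Coalgebra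
    open Coalgebra coalgebra public
    field
      start : State

  ℓ : (𝒳 : Coalgebra) → Coalgebra.State 𝒳 → Language
  ℓ 𝒳 s (end α)     = Coalgebra.δ 𝒳 s α ≡ accept
  ℓ 𝒳 s (α ⟨ p ⟩ x) = ∃[ t ] Coalgebra.δ 𝒳 s α ≡ step p t × ℓ 𝒳 t x

  G-map : ∀ {X Y} → (X → Y) → G X → G Y
  G-map f h α with h α
  ... | inj₁ r   = inj₁ r
  ... | step p x = step p (f x)

  accepts : ∀ {X} → Out X → Bool
  accepts (inj₁ r)   = r
  accepts (step _ _) = false

  -- The uniform continuation δ[Y,h], with Y ⊆ X given by its
  -- characteristic function.

  _[_,,_] : ∀ {X} → (X → G X) → (X → Bool) → G X → X → G X
  (δ [ Y ,, h ]) x α = if Y x ∧ accepts (δ x α) then h α else δ x α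

  _⊕_ : ∀ {X Y} → (X → G X) → (Y → G Y) → X ⊎ Y → G (X ⊎ Y)
  δ₁ ⊕ δ₂ = [ G-map inj₁ ∘ δ₁ , G-map inj₂ ∘ δ₂ ]

  X[_] : Exp → Set
  X[ act p ]      = ⊤
  X[ test b ]     = ⊥
  X[ f · g ]      = X[ f ] ⊎ X[ g ]
  X[ f +[ b ] g ] = X[ f ] ⊎ X[ g ]
  X[ f ^[ b ] ]   = X[ f ]

  -- By ≰⇒≤∼ and ≤∼⇒≰, the else branches of the tests α ≤? b are exactly the
  -- cases α ≤ ∼ b.

  ι : ∀ e → G X[ e ]
  ι (act p)      α = step p tt
  ι (test b)     α = if does (α ≤? b) then accept else reject
  ι (f · g)      α = if accepts (ι f α) then G-map inj₂ (ι g) α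
                                        else G-map inj₁ (ι f) α
  ι (f +[ b ] g) α = if does (α ≤? b) then G-map inj₁ (ι f) α
                                      else G-map inj₂ (ι g) α
  ι (f ^[ b ])   α = if does (α ≤? b)
                     then (if accepts (ι f α) then reject else ι f α)
                     else accept

  δ[_] : ∀ e → X[ e ] → G X[ e ]
  δ[ act p ]      = λ _ _ → accept
  δ[ test b ]     = λ ()
  δ[ f · g ]      = (δ[ f ] ⊕ δ[ g ])
                      [ [ (λ _ → true) , (λ _ → false) ] ,, G-map inj₂ (ι g) ]
  δ[ f +[ b ] g ] = δ[ f ] ⊕ δ[ g ]
  δ[ f ^[ b ] ]   = δ[ f ] [ (λ _ → true) ,, ι (f ^[ b ]) ]

  -- The adjoined start state is inj₁ tt.

  thompson : Exp → Automaton
  thompson e = record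
    { coalgebra = record
      { State = ⊤ ⊎ X[ e ]
      ; δ     = [ (λ _ → G-map inj₂ (ι e)) , G-map inj₂ ∘ δ[ e ] ]
      }
    ; start = inj₁ tt
    }

{-# OPTIONS --safe #-}

-- Splicing a continuation k into the accepting outputs of a coalgebra turns
-- the language L of a (pseudo)state into L ◇ K, where K is the language of k;
-- this holds even when k itself steps into the spliced coalgebra.  For f · g
-- the continuation is ι g, and for f ^[ b ] it is the new pseudostate itself,
-- so its language K consists of the atoms outside b and the strings of
-- (b · f) ◇ K whose left factor makes a step.  Left factors without a step do
-- not change the string, and the others shorten it, so K is the iteration.

module Submission where

open import Defs
open import Data.Bool using (if_then_else_)
open import Data.Maybe using (just)
open import Data.Nat using (ℕ; zero; suc; NonZero; _≤_; _<_; s≤s)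
open import Data.Nat.Induction using (<-wellFounded)
open import Data.Nat.Properties using (≤-refl; m≤n⇒m≤1+n)
open import Data.Product using (∃-syntax; _×_; _,_; proj₁; proj₂)
open import Data.Sum using (inj₁; inj₂)
open import Data.Unit using (tt)
open import Function using (id)
open import Induction.WellFounded using (Acc; acc)
open import Level using (0ℓ)
open import Relation.Binary.PropositionalEquality
  using (_≡_; refl; sym; trans; cong)
open import Relation.Nullary using (yes; no; contradiction)
open import Relation.Nullary.Decidable using (dec-true; dec-false)
open import Relation.Unary using (Pred; _∈_; _⊆_; _≐_; ∁)
open import Relation.Unary.Properties using (≐-trans)

module Correctness (Action : Set) (n : ℕ) where

  open GKAT Action n hiding (_≤_)

  -- Fusion of guarded strings.

  -- The graph of the partial operation `⋄`, so that definedness and the test on atoms turn into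
  -- pattern matching on the left factor.
  data Fusion : GS → GS → GS → Set where
    here  : ∀ {y} → Fusion (end (head y)) y y
    there : ∀ {α p x y w} → Fusion x y w → Fusion (α ⟨ p ⟩ x) y (α ⟨ p ⟩ w)

  ⋄⇒Fusion : ∀ x y {w} → x ⋄ y ≡ just w → Fusion x y w
  ⋄⇒Fusion (end α) y eq with α ≟ head y
  ⋄⇒Fusion (end α) y refl | yes refl = here
  ⋄⇒Fusion (end α) y ()   | no _
  ⋄⇒Fusion (α ⟨ p ⟩ x) y eq with x ⋄ y in eq′
  ⋄⇒Fusion (α ⟨ p ⟩ x) y refl | just _ = there (⋄⇒Fusion x y eq′)

  Fusion⇒⋄ : ∀ {x y w} → Fusion x y w → x ⋄ y ≡ just w
  Fusion⇒⋄ (here {y}) with head y ≟ head y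
  ... | yes _   = refl
  ... | no  h≢h = contradiction refl h≢h
  Fusion⇒⋄ (there {x = x} {y} F) rewrite Fusion⇒⋄ F = refl

  Fusion-head : ∀ {x y w} → Fusion x y w → head w ≡ head x
  Fusion-head here      = refl
  Fusion-head (there _) = refl

  here′ : ∀ {α y} → α ≡ head y → Fusion (end α) y y
  here′ refl = here

  Fusion-endʳ : ∀ {x α w} → Fusion x (end α) w → w ≡ x
  Fusion-endʳ here      = refl
  Fusion-endʳ (there F) = cong (_ ⟨ _ ⟩_) (Fusion-endʳ F)

  Fusion-assocʳ : ∀ {x y z xy w} → Fusion x y xy → Fusion xy z w →
                  ∃[ yz ] Fusion x yz w × Fusion y z yz
  Fusion-assocʳ here      G         = _ , here′ (sym (Fusion-head G)) , G
  Fusion-assocʳ (there F) (there G) with Fusion-assocʳ F G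
  ... | _ , F′ , G′ = _ , there F′ , G′

  Fusion-assocˡ : ∀ {x y z yz w} → Fusion x yz w → Fusion y z yz →
                  ∃[ xy ] Fusion x y xy × Fusion xy z w
  Fusion-assocˡ here      G = _ , here′ (Fusion-head G) , G
  Fusion-assocˡ (there F) G with Fusion-assocˡ F G
  ... | _ , F′ , G′ = _ , there F′ , there G′

  length : GS → ℕ
  length (end _)     = zero
  length (_ ⟨ _ ⟩ x) = suc (length x)

  -- Supplies the decreasing measure for iteration, where `y` is the string left over after one
  -- round.
  Fusion-lengthʳ : ∀ {x y w} → Fusion x y w → length y ≤ length w
  Fusion-lengthʳ here      = ≤-refl
  Fusion-lengthʳ (there F) = m≤n⇒m≤1+n (Fusion-lengthʳ F)

  -- Fusion of languages, powers and iteration.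

  ◇-intro : ∀ {L K : Language} {x y w} → x ∈ L → y ∈ K → Fusion x y w → w ∈ L ◇ K
  ◇-intro x∈L y∈K F = _ , _ , x∈L , y∈K , Fusion⇒⋄ F

  ◇-elim : ∀ {L K : Language} {w} → w ∈ L ◇ K →
           ∃[ x ] ∃[ y ] x ∈ L × y ∈ K × Fusion x y w
  ◇-elim (x , y , x∈L , y∈K , eq) = x , y , x∈L , y∈K , ⋄⇒Fusion x y eq

  ◇-mono : ∀ {L L′ K K′ : Language} → L ⊆ L′ → K ⊆ K′ → L ◇ K ⊆ L′ ◇ K′
  ◇-mono f g (x , y , x∈L , y∈K , eq) = x , y , f x∈L , g y∈K , eq

  ◇-cong : ∀ {L L′ K K′ : Language} → L ≐ L′ → K ≐ K′ → L ◇ K ≐ L′ ◇ K′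
  ◇-cong {L} {L′} {K} {K′} (f , f⁻) (g , g⁻) =
    ◇-mono {L} {L′} {K} {K′} f g , ◇-mono {L′} {L} {K′} {K} f⁻ g⁻

  ◇-assocʳ : ∀ {L K M : Language} → (L ◇ K) ◇ M ⊆ L ◇ (K ◇ M)
  ◇-assocʳ {L} {K} {M} w∈ with ◇-elim {L ◇ K} {M} w∈
  ... | _ , _ , xy∈ , z∈ , F with ◇-elim {L} {K} xy∈
  ... | _ , _ , x∈ , y∈ , F′ with Fusion-assocʳ F′ F
  ... | _ , G , G′ = ◇-intro {L} {K ◇ M} x∈ (◇-intro {K} {M} y∈ z∈ G′) G

  ◇-assocˡ : ∀ {L K M : Language} → L ◇ (K ◇ M) ⊆ (L ◇ K) ◇ M
  ◇-assocˡ {L} {K} {M} w∈ with ◇-elim {L} {K ◇ M} w∈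
  ... | _ , _ , x∈ , yz∈ , F with ◇-elim {K} {M} yz∈
  ... | _ , _ , y∈ , z∈ , F′ with Fusion-assocˡ F F′
  ... | _ , G , G′ = ◇-intro {L ◇ K} {M} (◇-intro {L} {K} x∈ y∈ G) z∈ G′

  guard-intro : ∀ {B : Pred At 0ℓ} {L : Language} {w} →
                head w ∈ B → w ∈ L → w ∈ ⌊ B ⌋ ◇ L
  guard-intro {B} {L} h∈B w∈L = ◇-intro {⌊ B ⌋} {L} (_ , h∈B , refl) w∈L here

  guard-elim : ∀ {B : Pred At 0ℓ} {L : Language} {w} →
               w ∈ ⌊ B ⌋ ◇ L → head w ∈ B × w ∈ L
  guard-elim {B} {L} (_ , y , (α , α∈B , refl) , y∈L , eq) with α ≟ head y
  guard-elim {B} {L} (_ , y , (_ , h∈B , refl) , y∈L , refl) | yes refl = h∈B , y∈L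

  -- Powers grow on the right, but a run of the automaton adds rounds on the left; associativity
  -- moves the factor across.
  ^-sucˡ : ∀ (L : Language) k → L ◇ (L ^ k) ⊆ L ^ suc k
  ^-sucˡ L zero {w} w∈ with ◇-elim {L} {L ^ zero} w∈
  ... | _ , _ , x∈L , (_ , _ , refl) , F
    rewrite Fusion-endʳ F = guard-intro {_} {L} tt x∈L
  ^-sucˡ L (suc k) w∈ =
    ◇-mono {L ◇ (L ^ k)} {L ^ suc k} {L} {L} (^-sucˡ L k) id
      (◇-assocˡ {L} {L ^ k} {L} w∈)

  -- The factors are absorbed one by one, starting with the rightmost. This is the induction behind
  -- iteration being a least fixed point.
  ^-absorb : ∀ {L K : Language} → L ◇ K ⊆ K → ∀ k → (L ^ k) ◇ K ⊆ K
  ^-absorb {L} {K} LK⊆K zero w∈ with guard-elim {_} {K} w∈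
  ... | _ , w∈K = w∈K
  ^-absorb {L} {K} LK⊆K (suc k) w∈ =
    ^-absorb {L} {K} LK⊆K k
      (◇-mono {L ^ k} {L ^ k} {L ◇ K} {K} id LK⊆K
        (◇-assocʳ {L ^ k} {L} {K} w∈))

  iteration-unfold : ∀ {B : Pred At 0ℓ} {L : Language} →
    (⌊ B ⌋ ◇ L) ◇ guarded-iteration B L ⊆ guarded-iteration B L
  iteration-unfold {B} {L} (x , y , x∈ , (k , y∈) , eq) =
    suc k , ◇-mono {M ◇ (M ^ k)} {M ^ suc k} {E} {E} (^-sucˡ M k) id
              (◇-assocˡ {M} {M ^ k} {E} (x , y , x∈ , y∈ , eq))
    where
    M E : Language
    M = ⌊ B ⌋ ◇ L
    E = ⌊ ∁ B ⌋

  -- Languages of pseudostates.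

  ⟪_⟫ : ∀ {X} → (X → G X) → Coalgebra
  ⟪ δ ⟫ = record { δ = δ }

  -- The language a state would have if its transitions were `h`; this gives `ι e` a language before
  -- any start state is adjoined.
  lang : ∀ {X} → (X → G X) → G X → Language
  lang δ h (end α)     = h α ≡ accept
  lang δ h (α ⟨ p ⟩ x) = ∃[ t ] h α ≡ step p t × ℓ ⟪ δ ⟫ t x

  ℓ⇒lang : ∀ {X} {δ : X → G X} {s} → ℓ ⟪ δ ⟫ s ⊆ lang δ (δ s)
  ℓ⇒lang {x = end _}     w∈ = w∈
  ℓ⇒lang {x = _ ⟨ _ ⟩ _} w∈ = w∈

  lang⇒ℓ : ∀ {X} {δ : X → G X} {s} → lang δ (δ s) ⊆ ℓ ⟪ δ ⟫ s
  lang⇒ℓ {x = end _}     w∈ = w∈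
  lang⇒ℓ {x = _ ⟨ _ ⟩ _} w∈ = w∈

  -- Only the first transition consults `h`. Pointwise equations between transition maps therefore
  -- suffice, without function extensionality.
  lang-local : ∀ {X} {δ : X → G X} {h h′ : G X} w →
               h (head w) ≡ h′ (head w) → w ∈ lang δ h → w ∈ lang δ h′
  lang-local (end _)     eq w∈            = trans (sym eq) w∈
  lang-local (_ ⟨ _ ⟩ _) eq (t , eq′ , w∈) = t , trans (sym eq) eq′ , w∈

  -- Coalgebra homomorphisms preserve languages, by induction on the string. It is applied to
  -- coproduct injections.
  lang-map : ∀ {X Y} {δ : X → G X} {ε : Y → G Y} (i : X → Y) →
           (∀ x α → ε (i x) α ≡ G-map i (δ x) α) →
           ∀ h → lang ε (G-map i h) ≐ lang δ h
  lang-map {δ = δ} {ε} i hom h = (λ {w} → to h w) , (λ {w} → from h w)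
    where
    to : ∀ h w → w ∈ lang ε (G-map i h) → w ∈ lang δ h
    to h (end α) eq with h α
    to h (end α) refl | accept = refl
    to h (α ⟨ p ⟩ w) (t , eq , w∈) with h α
    to h (α ⟨ p ⟩ w) (_ , refl , w∈) | step p x =
      x , refl , lang⇒ℓ (to (δ x) w (lang-local w (hom x _) (ℓ⇒lang w∈)))

    from : ∀ h w → w ∈ lang δ h → w ∈ lang ε (G-map i h)
    from h (end α) eq rewrite eq = refl
    from h (α ⟨ p ⟩ w) (x , eq , w∈) rewrite eq =
      i x , refl ,
      lang⇒ℓ (lang-local w (sym (hom x _)) (from (δ x) w (ℓ⇒lang w∈)))

  -- Splicing in a continuation.

  -- One form for both uses of uniform continuation: `i` is `inj₁` for `f · g` and `id` for
  -- `f ^[ b ]`.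
  resume : ∀ {X Y} → (X → Y) → G Y → G X → G Y
  resume i k h α = if accepts (h α) then k α else G-map i h α

  module _ {X Y} {δ : X → G X} {ε : Y → G Y} (i : X → Y) (k : G Y)
           (continues : ∀ x α → ε (i x) α ≡ resume i k (δ x) α) where

    private
      K : Language
      K = lang ε k

      to : ∀ h w → w ∈ lang ε (resume i k h) → w ∈ lang δ h ◇ K
      to h (end α) eq with h α in hα
      to h (end α) eq | accept = ◇-intro {lang δ h} {K} hα eq here
      to h (end α) () | reject
      to h (end α) () | step _ _
      to h w@(α ⟨ p ⟩ w′) (t , eq , w∈) with h α in hα
      -- Here `h` hands over to `k` at once: the left factor is the atom `α`, and the right factor
      -- is all of `w`.
      to h w@(α ⟨ p ⟩ w′) (t , eq , w∈) | accept =
        ◇-intro {lang δ h} {K} {y = w} hα (t , eq , w∈) here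
      to h w@(α ⟨ p ⟩ w′) (t , () , w∈) | reject
      to h w@(α ⟨ p ⟩ w′) (_ , refl , w∈) | step p x
        with ◇-elim {lang δ (δ x)} {K}
               (to (δ x) w′ (lang-local w′ (continues x _) (ℓ⇒lang w∈)))
      ... | _ , _ , u∈ , v∈ , F =
        ◇-intro {lang δ h} {K} (x , hα , lang⇒ℓ u∈) v∈ (there F)

      from : ∀ h {u v w} → u ∈ lang δ h → v ∈ K → Fusion u v w →
             w ∈ lang ε (resume i k h)
      -- The left factor is the atom `head v`, where `h` accepts, so the spliced map agrees with `k`
      -- at that atom.
      from h {v = v} u∈ v∈ here =
        lang-local v (sym (cong (λ o → if accepts o then k _ else G-map i h _) u∈)) v∈
      from h (x , eq , u∈) v∈ (there {α} {p} {w = w} F) =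
        i x , resumes ,
        lang⇒ℓ (lang-local w (sym (continues x _)) (from (δ x) (ℓ⇒lang u∈) v∈ F))
        where
        resumes : resume i k h α ≡ step p (i x)
        resumes rewrite eq = refl

    lang-resume : ∀ h → lang ε (resume i k h) ≐ lang δ h ◇ lang ε k
    lang-resume h = (λ {w} → to h w) , λ w∈ →
      let (_ , _ , u∈ , v∈ , F) = ◇-elim {lang δ h} {K} w∈ in from h u∈ v∈ F

    ℓ-resume : ∀ x → ℓ ⟪ ε ⟫ (i x) ≐ ℓ ⟪ δ ⟫ x ◇ lang ε k
    ℓ-resume x = (λ {w} w∈ →
        ◇-mono {lang δ (δ x)} {ℓ ⟪ δ ⟫ x} {K} {K} lang⇒ℓ id
          (to (δ x) w (lang-local w (continues x _) (ℓ⇒lang w∈))))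
      , (λ {w} w∈ →
        let (_ , _ , u∈ , v∈ , F) = ◇-elim {ℓ ⟪ δ ⟫ x} {K} w∈ in
        lang⇒ℓ (lang-local w (sym (continues x _)) (from (δ x) (ℓ⇒lang u∈) v∈ F)))

  -- Guarded iteration.

  lang-iteration : ∀ f b →
    lang δ[ f ^[ b ] ] (ι (f ^[ b ])) ≐ guarded-iteration ⟦ b ⟧ᵇ (lang δ[ f ] (ι f))
  lang-iteration f b = (λ {w} → to w (<-wellFounded _)) , from
    where
    ε = δ[ f ^[ b ] ]
    k = ι (f ^[ b ])

    B : Pred At 0ℓ
    B = ⟦ b ⟧ᵇ

    L M K I : Language
    L = lang δ[ f ] (ι f)
    M = ⌊ B ⌋ ◇ L
    K = lang ε k
    I = guarded-iteration B L

    continues : ∀ x α → ε x α ≡ resume id k (δ[ f ] x) α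
    continues x α with δ[ f ] x α
    ... | accept   = refl
    ... | reject   = refl
    ... | step _ _ = refl

    spliced : ∀ x → ℓ ⟪ ε ⟫ x ≐ ℓ ⟪ δ[ f ] ⟫ x ◇ K
    spliced = ℓ-resume id k continues

    -- Inside `b` an accepting output of `ι f` is replaced by `reject`, so the loop can be left only
    -- where its guard fails.
    k-accept : ∀ α → k α ≡ accept → α ∈ ∁ B
    k-accept α eq α≤b rewrite dec-true (α ≤? b) α≤b with ι f α
    k-accept α () α≤b | accept
    k-accept α () α≤b | reject
    k-accept α () α≤b | step _ _

    k-accept⁻ : ∀ α → α ∈ ∁ B → k α ≡ accept
    k-accept⁻ α α≰b rewrite dec-false (α ≤? b) α≰b = refl

    k-step : ∀ α {p t} → k α ≡ step p t → α ∈ B × ι f α ≡ step p t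
    k-step α eq with α ≤? b
    ... | no α≰b = contradiction (trans (sym (k-accept⁻ α α≰b)) eq) λ ()
    ... | yes α≤b rewrite dec-true (α ≤? b) α≤b with ι f α
    k-step α () | yes α≤b | accept
    k-step α () | yes α≤b | reject
    k-step α eq | yes α≤b | step _ _ = α≤b , eq

    k-step⁻ : ∀ α {p t} → α ∈ B → ι f α ≡ step p t → k α ≡ step p t
    k-step⁻ α α≤b eq rewrite dec-true (α ≤? b) α≤b | eq = refl

    -- The remainder `v` is found by splitting `w` and is no structural subterm, hence the recursion
    -- on length. It is no longer than `w`, and the leading step makes the descent strict.
    to : ∀ w → Acc _<_ (length w) → w ∈ K → w ∈ I
    to (end α) _ eq =
      zero , guard-intro {_} {⌊ ∁ B ⌋} tt (α , k-accept α eq , refl)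
    to (α ⟨ p ⟩ w) (acc rec) (t , eq , w∈)
      with (spliced⇒ , _) ← spliced t
      with (α∈B , eq′) ← k-step α eq
      with (u , v , u∈ , v∈ , F) ← ◇-elim {ℓ ⟪ δ[ f ] ⟫ t} {K} (spliced⇒ w∈) =
        iteration-unfold {B} {L}
          (◇-intro {M} {I} (guard-intro {B} {L} α∈B (t , eq′ , u∈))
            (to v (rec (s≤s (Fusion-lengthʳ F))) v∈) (there F))

    MK⊆K : M ◇ K ⊆ K
    MK⊆K w∈ with ◇-elim {M} {K} w∈
    ... | _ , _ , u∈ , v∈ , F with guard-elim {B} {L} u∈
    -- Fusing an atom on the left gives back `v`, so no transition of `k` is needed, even though `k`
    -- rejects where `ι f` accepts inside `b`.
    MK⊆K w∈ | _ , _ , _ , v∈ , here | _ = v∈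
    MK⊆K w∈ | _ , _ , _ , v∈ , there F | α∈B , t , eq , u∈
      with (_ , spliced⇐) ← spliced t =
        t , k-step⁻ _ α∈B eq , spliced⇐ (◇-intro {ℓ ⟪ δ[ f ] ⟫ t} {K} u∈ v∈ F)

    -- `K` contains the exit atoms and is closed under prefixing a round, so it absorbs any number
    -- of rounds.
    from : I ⊆ K
    from (m , w∈) = ^-absorb {M} {K} MK⊆K m
      (◇-mono {M ^ m} {M ^ m} {⌊ ∁ B ⌋} {K} id
        (λ { (α , α∉B , refl) → k-accept⁻ α α∉B }) w∈)

  -- Induction on expressions and the start state.

  iteration-cong : ∀ {B : Pred At 0ℓ} {L L′ : Language} → L ≐ L′ →
                   guarded-iteration B L ≐ guarded-iteration B L′
  iteration-cong {B} {L} {L′} (L⊆ , L⊇) = mono L⊆ , mono L⊇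
    where
    mono-^ : ∀ {L L′ : Language} → L ⊆ L′ → ∀ k → L ^ k ⊆ L′ ^ k
    mono-^ L⊆ zero = id
    mono-^ {L} {L′} L⊆ (suc k) =
      ◇-mono {L ^ k} {L′ ^ k} {L} {L′} (mono-^ L⊆ k) L⊆

    mono : ∀ {L L′ : Language} → L ⊆ L′ →
           guarded-iteration B L ⊆ guarded-iteration B L′
    mono {L} {L′} L⊆ (k , w∈) = k ,
      ◇-mono {(⌊ B ⌋ ◇ L) ^ k} {(⌊ B ⌋ ◇ L′) ^ k} {⌊ ∁ B ⌋} {⌊ ∁ B ⌋}
        (mono-^ (◇-mono {⌊ B ⌋} {⌊ B ⌋} {L} {L′} id L⊆) k) id w∈

  -- Stated for pseudostates because the construction composes them; the start state is adjoined
  -- only once, at the end.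
  lang-ι : ∀ e → lang δ[ e ] (ι e) ≐ ⟦ e ⟧
  lang-ι (act p) = (λ {w} → to w) , λ { (α , β , refl) → tt , refl , refl }
    where
    to : ∀ w → w ∈ lang δ[ act p ] (ι (act p)) → w ∈ ⟦ act p ⟧
    to (α ⟨ p ⟩ end β) (_ , refl , _) = α , β , refl
  lang-ι (test b) = (λ {w} → to w) , λ { (α , α≤b , refl) → from α α≤b }
    where
    to : ∀ w → w ∈ lang δ[ test b ] (ι (test b)) → w ∈ ⟦ test b ⟧
    to (end α) eq with α ≤? b
    ... | yes α≤b = α , α≤b , refl
    ... | no  α≰b rewrite dec-false (α ≤? b) α≰b = contradiction eq λ ()
    to (α ⟨ _ ⟩ _) (() , _)

    from : ∀ α → α ∈ ⟦ b ⟧ᵇ → ι (test b) α ≡ accept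
    from α α≤b rewrite dec-true (α ≤? b) α≤b = refl
  lang-ι (f · g) =
    -- `ι (f · g)` unfolds to `resume inj₁ k (ι f)`. The states of `g` are left unspliced, so `inj₂`
    -- is a homomorphism by computation.
    ≐-trans (lang-resume inj₁ k continues (ι f))
      (◇-cong {lang δ[ f ] (ι f)} {⟦ f ⟧} (lang-ι f)
        (≐-trans (lang-map inj₂ (λ _ _ → refl) (ι g)) (lang-ι g)))
    where
    k = G-map inj₂ (ι g)

    continues : ∀ x α → δ[ f · g ] (inj₁ x) α ≡ resume inj₁ k (δ[ f ] x) α
    continues x α with δ[ f ] x α
    ... | accept   = refl
    ... | reject   = refl
    ... | step _ _ = refl
  lang-ι (f +[ b ] g) = (λ {w} → to w) , λ {w} → from w
    where
    e = f +[ b ] g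

    left : lang δ[ e ] (G-map inj₁ (ι f)) ≐ ⟦ f ⟧
    left = ≐-trans (lang-map inj₁ (λ _ _ → refl) (ι f)) (lang-ι f)

    right : lang δ[ e ] (G-map inj₂ (ι g)) ≐ ⟦ g ⟧
    right = ≐-trans (lang-map inj₂ (λ _ _ → refl) (ι g)) (lang-ι g)

    ι-yes : ∀ α → α ∈ ⟦ b ⟧ᵇ → ι e α ≡ G-map inj₁ (ι f) α
    ι-yes α α≤b rewrite dec-true (α ≤? b) α≤b = refl

    ι-no : ∀ α → α ∈ ∁ ⟦ b ⟧ᵇ → ι e α ≡ G-map inj₂ (ι g) α
    ι-no α α≰b rewrite dec-false (α ≤? b) α≰b = refl

    to : ∀ w → w ∈ lang δ[ e ] (ι e) → w ∈ ⟦ e ⟧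
    -- Both the guard and the choice made by `ι e` depend only on the first atom, so one case split
    -- settles the whole string.
    to w w∈ with head w ≤? b
    ... | yes h≤b = inj₁ (guard-intro {_} {⟦ f ⟧} h≤b
                      (proj₁ left (lang-local w (ι-yes _ h≤b) w∈)))
    ... | no  h≰b = inj₂ (guard-intro {_} {⟦ g ⟧} h≰b
                      (proj₁ right (lang-local w (ι-no _ h≰b) w∈)))

    from : ∀ w → w ∈ ⟦ e ⟧ → w ∈ lang δ[ e ] (ι e)
    from w (inj₁ w∈) = let (h≤b , w∈f) = guard-elim {⟦ b ⟧ᵇ} {⟦ f ⟧} w∈ in
      lang-local w (sym (ι-yes _ h≤b)) (proj₂ left w∈f)
    from w (inj₂ w∈) = let (h≰b , w∈g) = guard-elim {∁ ⟦ b ⟧ᵇ} {⟦ g ⟧} w∈ in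
      lang-local w (sym (ι-no _ h≰b)) (proj₂ right w∈g)
  lang-ι (f ^[ b ]) = ≐-trans (lang-iteration f b) (iteration-cong (lang-ι f))

  -- The start state has transitions `G-map inj₂ (ι e)`, and `inj₂` embeds `X[ e ]` as a
  -- subcoalgebra, which reduces the claim to the pseudostate.
  thompson-correct : ∀ e →
    ℓ (Automaton.coalgebra (thompson e)) (Automaton.start (thompson e)) ≐ ⟦ e ⟧
  thompson-correct e =
    ≐-trans (ℓ⇒lang , lang⇒ℓ)
      (≐-trans (lang-map inj₂ (λ _ _ → refl) (ι e)) (lang-ι e))

theorem4p1 : (Action : Set) (n : ℕ) → Action → .{{_ : NonZero n}} →
    let open GKAT Action n in
    (e : Exp) →
    ℓ (Automaton.coalgebra (thompson e)) (Automaton.start (thompson e)) ≐ ⟦ e ⟧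
theorem4p1 Action n _ e = Correctness.thompson-correct Action n e
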